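{- Trace semantics is compositional for streamlined stateful SOS specifications. That is, let $\mathcal L$ be a streamlined stateful SOS specification over a signature $\Sigma$ and a countable set $S$ of states. Then for every $n$-ary operator $\mathsf f\in\Sigma$ and all programs $p_i,q_i\in\mu\Sigma$ ($i=1,\dots,n$), if $\llbracket p_i\rrbracket_{\mathcal L}=\llbracket q_i\rrbracket_{\mathcal L}$ for $i=1,\dots,n$, then $\llbracket\mathsf f(p_1,\dots,p_n)\rrbracket_{\mathcal L}=\llbracket\mathsf f(q_1,\dots,q_n)\rrbracket_{\mathcal L}$, where $\llbracket-\rrbracket_{\mathcal L}$ denotes trace semantics.
   Context: **Signature and terms.** $\Sigma$ is an algebraic signature (operation symbols $\mathsf f$ with arities in $\mathbb N$), $\Sigma^\star X$ is the set of $\Sigma$-terms with variables from $X$, and $\mu\Sigma=\Sigma^\star\emptyset$ is the set of closed terms (programs). $\mathcal V=\{x_1,x_2,\dots\}\cup\{y_1,y_2,\dots\}$ is a countably infinite set of variables. $1=\{*\}$. **Specifications.** A progressing literal is $s,p\to s',q$ and a terminating literal is $s,p\downarrow s'$ (also written $s,p\to s',*$), with $s,s'\in S$, $p,q\in\Sigma^\star\mathcal V$ (input $s$, source $p$, output $s'$, target $q$). A stateful SOS rule for an $n$-ary $\mathsf f$ is an expression $l_1\dots l_n/L$ of literals (premisses $l_j$, conclusion $L$) with the same input $s$, such that the source of $l_j$ is $x_j$, its target is $y_j$ if it is progressing, the source of $L$ is $\mathsf f(x_1,\dots,x_n)$, and if $L$ is progressing all variables of its target appear as source or target of some premiss. The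 rule is progressing/terminating if $L$ is. Its trigger is $(s,(s_1',\mathtt c_1),\dots,(s_n',\mathtt c_n))$, where $s_j'$ is the output of $l_j$ and $\mathtt c_j=\mathtt{pr}$ or $\mathtt{te}$ according to whether $l_j$ is progressing or terminating. A stateful SOS specification is a set of rules containing, for each $n$-ary $\mathsf f$ and each $(s,(s_1',\mathtt c_1),\dots,(s_n',\mathtt c_n))$ with $s,s_j'\in S$, $\mathtt c_j\in\{\mathtt{pr},\mathtt{te}\}$, exactly one rule for $\mathsf f$ with that trigger. Convention: a rule written with some premisses omitted stands for the set of all rules obtained by filling in the missing premisses in any possible way (so the conclusion does not depend on the omitted premisses). **Transition function.** $\gamma_0\colon S\times\mu\Sigma\to S\times(\mu\Sigma+1)$ is defined by induction on programs: for $p=\mathsf f(t_1,\dots,t_n)$ let $(s_j',w_j)=\gamma_0(s,t_j)$, and take the unique rule for $\mathsf f$ with trigger $(s,(s_1',\mathtt c_1),\dots,(s_n',\mathtt c_n))$, where $\mathtt c_j=\mathtt{te}$ if $w_j=*$ and $\mathtt c_j=\mathtt{pr}$ otherwise; with $s'$ the output of its conclusion, $\gamma_0(s,p)=(s',*)$ if the rule is terminating, and otherwise $\gamma_0(s,p)=(s',t')$, where $t'$ is the target of the conclusion with $x_j$ replaced by $t_j$ and $y_j$ by $w_j$. Write $s,p\to s',p'$ if $\gamma_0(s,p)=(s',p')$, and $s,p\downarrow s'$ if $\gamma_0(s,p)=(s',*)$. **Trace semantics.** $\llbracket-\rrbracket_{\mathcal L}\colon\mu\Sigma\to(S^{+}+S^{\omega})^S$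 (with $S^+$ the nonempty finite and $S^\omega$ the infinite sequences over $S$) sends $p$ and $s$ to the possibly terminating sequence of states $s_1s_2s_3\cdots$ computed by $p$ on input $s$: $s,p\to s_1,p_1\to s_2,p_2\to\cdots$; if some step is terminating, $s_{k-1},p_{k-1}\downarrow s_k$, the sequence is $s_1\cdots s_k$. **Passive/active operators, receiving rules.** An $n$-ary operator $\mathsf f$ is passive if all rules for $\mathsf f$ are of the form $\dfrac{}{s,\mathsf f(x_1,\dots,x_n)\to s',t}$ (all premisses omitted) with $t\in\Sigma^\star(\{x_1,\dots,x_n\})$ or $t=*$; i.e. for each input $s$ the output $s'$ and target $t$ (or termination) are the same for all choices of premisses. Otherwise $\mathsf f$ is active. A progressing rule for $\mathsf f$ is receiving at position $j$ if its $j$-th premiss $s,x_j\to s',y_j$ is progressing and $y_j$ appears in the target of the conclusion; it is receiving if it is receiving at some position. **Streamlined.** A stateful SOS specification is streamlined if for every active operator $\mathsf f$ of arity $n$ there exists $j\in\{1,\dots,n\}$ such that: (1) all receiving rules for $\mathsf f$ are of the form $\dfrac{s,x_j\to s',y_j}{s,\mathsf f(x_1,\dots,x_n)\to s',t}$ (all premisses but the $j$-th omitted) where $t=\mathsf f(x_1,\dots,x_n)[y_j/x_j]$ or $t=y_j$, with $[u/x]$ denoting substitution of the variable $x$ by the term $u$; (2) all non-receiving rules for $\mathsf f$ are of the form $\dfrac{l_1\ \ l_2\ \cdots\ l_n}{s,\mathsf f(x_1,\dots,x_n)\to s',t}$ where $t\in\Sigma^\star(\{x_1,\dots,x_n\}\smallsetminus\{x_j\})$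 or $t=*$. -}

module Defs where

open import Data.Bool.Base using (if_then_else_)
open import Data.Empty using (⊥)
open import Data.Fin.Base using (Fin; toℕ)
open import Data.Maybe.Base using (Maybe; just; nothing)
open import Data.Maybe using (Is-just)
open import Data.Maybe.Relation.Unary.Any as MaybeAny using ()
open import Data.Nat.Base using (ℕ; zero; suc)
import Data.Nat.Properties as ℕ
open import Data.Product using (∃; ∃!; _×_; _,_; proj₁; proj₂; map₂)
open import Data.Sum.Base using (_⊎_; inj₁; inj₂)
open import Data.Sum.Properties using (≡-dec)
open import Data.Unit.Base using (tt)
open import Data.Vec.Base using (Vec; []; _∷_; lookup; map; tabulate)
open import Data.Vec.Properties using (lookup-map)
open import Data.Vec.Relation.Unary.Any using (Any; here; there)
open import Level using (0ℓ)
open import Relation.Binary.Definitions using (DecidableEquality)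
open import Relation.Binary.PropositionalEquality
  using (_≡_; refl; cong; module ≡-Reasoning)
open import Relation.Nullary using (¬_; does)
open import Relation.Unary using (Pred; _∖_; ｛_｝; _∈_)

record Signature : Set₁ where
  field
    Op    : Set
    arity : Op → ℕ

open Signature public

data Term (𝕊 : Signature) (X : Set) : Set where
  var : X → Term 𝕊 X
  op  : (f : Op 𝕊) → Vec (Term 𝕊 X) (arity 𝕊 f) → Term 𝕊 X

μ : Signature → Set
μ 𝕊 = Term 𝕊 ⊥

module _ {𝕊 : Signature} where

  infix 4 _occursIn_

  data _occursIn_ {X : Set} (v : X) : Term 𝕊 X → Set where
    here  : v occursIn var v
    there : ∀ {f ts} → Any (v occursIn_) ts → v occursIn op f ts

  -- Simultaneous substitution; the substitution need only be defined on the
  -- variables occurring in the term.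
  bind  : {X Y : Set} (t : Term 𝕊 X) →
          (∀ v → v occursIn t → Term 𝕊 Y) → Term 𝕊 Y
  binds : ∀ {X Y : Set} {n} (ts : Vec (Term 𝕊 X) n) →
          (∀ v → Any (v occursIn_) ts → Term 𝕊 Y) → Vec (Term 𝕊 Y) n

  bind (var v)   σ = σ v here
  bind (op f ts) σ = op f (binds ts (λ v i → σ v (there i)))

  binds []       σ = []
  binds (t ∷ ts) σ = bind t (λ v i → σ v (here i)) ∷ binds ts (λ v i → σ v (there i))

-- Indices start at 0: the variables x₁, x₂, … and y₁, y₂, … are x 0, x 1, …
-- and y 0, y 1, ….
𝒱 : Set
𝒱 = ℕ ⊎ ℕ

pattern x i = inj₁ i
pattern y i = inj₂ i

_≟𝒱_ : DecidableEquality 𝒱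
_≟𝒱_ = ≡-dec ℕ._≟_ ℕ._≟_

_[_/_] : {𝕊 : Signature} → Term 𝕊 𝒱 → Term 𝕊 𝒱 → 𝒱 → Term 𝕊 𝒱
t [ u / z ] = bind t (λ v _ → if does (v ≟𝒱 z) then u else var v)

data Kind : Set where
  pr te : Kind

-- Maybe A stands for A + 1, with `nothing` the termination symbol *.
kind : {A : Set} → Maybe A → Kind
kind (just _) = pr
kind nothing  = te

fromPr : {A : Set} (w : Maybe A) → kind w ≡ pr → A
fromPr (just a) _ = a

-- {x₁,…,xₙ}
Xs : ℕ → Pred 𝒱 0ℓ
Xs n v = ∃ λ (j : Fin n) → v ≡ x (toℕ j)

module _ {𝕊 : Signature} where

  -- f(x₁,…,xₙ)
  generic : Op 𝕊 → Term 𝕊 𝒱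
  generic f = op f (tabulate (λ j → var (x (toℕ j))))

  -- w ∈ Σ*P + 1, that is, w ∈ Σ*P or w = *.
  VarsIn : Pred 𝒱 0ℓ → Maybe (Term 𝕊 𝒱) → Set
  VarsIn P w = ∀ {t} → w ≡ just t → ∀ v → v occursIn t → v ∈ P

module _ (𝕊 : Signature) (S : Set) where

  -- The literal s,p → s',q has target `just q`; the literal s,p ↓ s', also
  -- written s,p → s',*, has target `nothing`.
  record Literal : Set where
    constructor literal
    field
      input  : S
      source : Term 𝕊 𝒱
      output : S
      target : Maybe (Term 𝕊 𝒱)

  -- An expression l₁ … lₙ / L.
  record Expression (f : Op 𝕊) : Set where
    constructor _／_
    field
      premisses  : Vec Literal (arity 𝕊 f)
      conclusion : Literal

    premiss : Fin (arity 𝕊 f) → Literal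
    premiss = lookup premisses

  Trigger : Op 𝕊 → Set
  Trigger f = S × Vec (S × Kind) (arity 𝕊 f)

module _ {𝕊 : Signature} {S : Set} where

  open Literal
  open Expression

  trigger : ∀ {f} → Expression 𝕊 S f → Trigger 𝕊 S f
  trigger r = input (conclusion r)
            , map (λ l → output l , kind (target l)) (premisses r)

  record IsRule {f : Op 𝕊} (r : Expression 𝕊 S f) : Set where
    field
      same-input        : ∀ j → input (premiss r j) ≡ input (conclusion r)
      premiss-source    : ∀ j → source (premiss r j) ≡ var (x (toℕ j))
      premiss-target    : ∀ j {t} → target (premiss r j) ≡ just t → t ≡ var (y (toℕ j))
      conclusion-source : source (conclusion r) ≡ generic f
      conclusion-vars   : VarsIn (λ v → ∃ λ j → source (premiss r j) ≡ var v
                                              ⊎ target (premiss r j) ≡ just (var v))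
                                 (target (conclusion r))

record Specification (𝕊 : Signature) (S : Set) : Set₁ where
  field
    Rules       : ∀ f → Pred (Expression 𝕊 S f) 0ℓ
    isRule      : ∀ {f r} → r ∈ Rules f → IsRule r
    exactly-one : ∀ f (τ : Trigger 𝕊 S f) → ∃! _≡_ (λ r → r ∈ Rules f × trigger r ≡ τ)

-- S⁺ + S^ω: a nonempty, possibly terminating sequence s₁ s₂ … is presented by
-- its entries (`at k` is the entry with index k + 1), with `nothing` past the end.
record Sequence (S : Set) : Set where
  field
    at       : ℕ → Maybe S
    nonempty : Is-just (at 0)
    closed   : ∀ k → at k ≡ nothing → at (suc k) ≡ nothing

open Sequence public

infix 4 _≈_

_≈_ : {S : Set} → Sequence S → Sequence S → Set
σ ≈ τ = ∀ k → at σ k ≡ at τ k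

module Semantics {𝕊 : Signature} {S : Set} (𝓛 : Specification 𝕊 S) where

  open Specification 𝓛
  open Literal
  open Expression
  open IsRule

  -- One step of f(t₁,…,tₙ), where ws lists the pairs (s'_j , w_j) = γ₀ (s , t_j) and
  -- r is the rule for the resulting trigger.
  module _ {f : Op 𝕊} {r : Expression 𝕊 S f} (r∈ : r ∈ Rules f)
           (ts : Vec (μ 𝕊) (arity 𝕊 f)) (ws : Vec (S × Maybe (μ 𝕊)) (arity 𝕊 f))
           (τ≡ : proj₂ (trigger r) ≡ map (map₂ kind) ws) where

    progresses : ∀ j {u} → target (premiss r j) ≡ just u →
                 kind (proj₂ (lookup ws j)) ≡ pr
    progresses j {u} eq = begin
      kind (proj₂ (lookup ws j))             ≡⟨ cong proj₂ (lookup-map j (map₂ kind) ws) ⟨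
      proj₂ (lookup (map (map₂ kind) ws) j)  ≡⟨ cong (λ τ → proj₂ (lookup τ j)) τ≡ ⟨
      proj₂ (lookup (proj₂ (trigger r)) j)   ≡⟨ cong proj₂ (lookup-map j _ (premisses r)) ⟩
      kind (target (premiss r j))            ≡⟨ cong kind eq ⟩
      pr                                     ∎
      where open ≡-Reasoning

    -- A variable that is the source of the j-th premiss is x_j and is replaced by
    -- t_j; one that is its target is y_j and is replaced by w_j, which is then not *.
    value : ∀ v → (∃ λ j → source (premiss r j) ≡ var v
                         ⊎ target (premiss r j) ≡ just (var v)) → μ 𝕊
    value v (j , inj₁ _)  = lookup ts j
    value v (j , inj₂ eq) = fromPr (proj₂ (lookup ws j)) (progresses j eq)

    instantiate : (w : Maybe (Term 𝕊 𝒱)) → target (conclusion r) ≡ w → Maybe (μ 𝕊)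
    instantiate nothing  _  = nothing
    instantiate (just t) eq =
      just (bind t (λ v i → value v (conclusion-vars (isRule r∈) eq v i)))

    step : S × Maybe (μ 𝕊)
    step = output (conclusion r) , instantiate (target (conclusion r)) refl

  γ-op : (f : Op 𝕊) → S → Vec (μ 𝕊) (arity 𝕊 f) →
         Vec (S × Maybe (μ 𝕊)) (arity 𝕊 f) → S × Maybe (μ 𝕊)
  γ-op f s ts ws =
    let r , (r∈ , τ≡) , _ = exactly-one f (s , map (map₂ kind) ws)
    in  step r∈ ts ws (cong proj₂ τ≡)

  γ₀  : S → μ 𝕊 → S × Maybe (μ 𝕊)
  γ₀s : ∀ {n} → S → Vec (μ 𝕊) n → Vec (S × Maybe (μ 𝕊)) n

  γ₀ s (op f ts) = γ-op f s ts (γ₀s s ts)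

  γ₀s s []       = []
  γ₀s s (t ∷ ts) = γ₀ s t ∷ γ₀s s ts

  states : S × Maybe (μ 𝕊) → ℕ → Maybe S
  states (s , _)       zero    = just s
  states (s , just p)  (suc k) = states (γ₀ s p) k
  states (s , nothing) (suc k) = nothing

  ⟦_⟧ : μ 𝕊 → S → Sequence S
  ⟦ p ⟧ s = record
    { at       = states (γ₀ s p)
    ; nonempty = MaybeAny.just tt
    ; closed   = closed′ (γ₀ s p)
    }
    where
    closed′ : ∀ c k → states c k ≡ nothing → states c (suc k) ≡ nothing
    closed′ (s , just p)  (suc k) eq = closed′ (γ₀ s p) k eq
    closed′ (s , nothing) (suc k) eq = refl

module Format {𝕊 : Signature} {S : Set} (𝓛 : Specification 𝕊 S) where

  open Specification 𝓛
  open Literal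
  open Expression

  -- A rule with omitted premisses stands for all rules obtained by filling them
  -- in, so the form required here says that the conclusion is determined by the input.
  Passive : Op 𝕊 → Set
  Passive f = ∀ {r} → r ∈ Rules f →
      VarsIn (Xs (arity 𝕊 f)) (target (conclusion r))
    × (∀ {r′} → r′ ∈ Rules f → input (conclusion r′) ≡ input (conclusion r) →
       conclusion r′ ≡ conclusion r)

  Active : Op 𝕊 → Set
  Active f = ¬ Passive f

  ReceivingAt : ∀ {f} → Fin (arity 𝕊 f) → Expression 𝕊 S f → Set
  ReceivingAt j r =
      kind (target (premiss r j)) ≡ pr
    × ∃ λ t → target (conclusion r) ≡ just t × y (toℕ j) occursIn t

  Receiving : ∀ {f} → Expression 𝕊 S f → Set
  Receiving r = ∃ λ j → ReceivingAt j r

  -- The last component accounts for the omission of all premisses but the j-th: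
  -- each way of filling them in is a rule with the same conclusion.
  ReceivingForm : ∀ {f} → Fin (arity 𝕊 f) → Expression 𝕊 S f → Set
  ReceivingForm {f} j r =
      kind (target (premiss r j)) ≡ pr
    × output (conclusion r) ≡ output (premiss r j)
    × ( target (conclusion r) ≡ just (generic f [ var (y (toℕ j)) / x (toℕ j) ])
      ⊎ target (conclusion r) ≡ just (var (y (toℕ j))))
    × (∀ {r′} → r′ ∈ Rules f → premiss r′ j ≡ premiss r j → conclusion r′ ≡ conclusion r)

  NonReceivingForm : ∀ {f} → Fin (arity 𝕊 f) → Expression 𝕊 S f → Set
  NonReceivingForm {f} j r = VarsIn (Xs (arity 𝕊 f) ∖ ｛ x (toℕ j) ｝) (target (conclusion r))

  Streamlined : Set
  Streamlined = ∀ f → Active f → ∃ λ (j : Fin (arity 𝕊 f)) →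
      (∀ {r} → r ∈ Rules f → Receiving r → ReceivingForm j r)
    × (∀ {r} → r ∈ Rules f → ¬ Receiving r → NonReceivingForm j r)

{-# OPTIONS --safe #-}

-- Compare configurations by their first k transitions, and call programs
-- k-equivalent if they are so related on every input.  By induction on k, this
-- is a congruence.  The first transitions of f(p₁,…,pₙ) and f(q₁,…,qₙ) have
-- rules with the same conclusion, and if its target mentions only variables xᵢ
-- with pᵢ and qᵢ equivalent, the residuals are related by the induction
-- hypothesis.  A receiving rule of an active operator passes on the state and
-- residual of the j-th argument, but the residuals on both sides are related on
-- that one state only.  The induction for active operators therefore assumes the
-- j-th arguments to be related only on the current state; this suffices since
-- non-receiving rules discard x_j.
--
-- Passivity need not be decidable, but the countability of S makes the relation
-- on configurations stable under double negation, so that one may argue by cases.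
module Submission where

open import Defs
open import Data.Bool.Base using (if_then_else_)
open import Data.Fin.Base using (Fin; zero; suc; toℕ)
import Data.Fin.Properties as Fin
open import Data.Maybe.Base using (Maybe; just; nothing)
open import Data.Maybe.Properties using (just-injective)
open import Data.Nat.Base using (ℕ; zero; suc)
import Data.Nat.Properties as ℕ
open import Data.Product using (∃; _×_; _,_; proj₁; proj₂; map₂)
open import Data.Sum.Base using (_⊎_; inj₁; inj₂)
open import Data.Sum.Properties using (inj₁-injective; inj₂-injective)
open import Data.Vec.Base using (Vec; []; _∷_; lookup; map; tabulate)
open import Data.Vec.Properties using (lookup-map; lookup∘tabulate)
open import Data.Vec.Relation.Unary.Any using (Any; here; there)
open import Function.Base using (_∘_)
open import Function.Bundles using (_↣_)
open import Relation.Binary.Definitions using (DecidableEquality)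
open import Relation.Binary.PropositionalEquality
  using (_≡_; _≢_; refl; sym; trans; cong; cong₂; subst; subst₂)
open import Relation.Nullary using (¬_; does; yes; no; contradiction)
open import Relation.Nullary.Decidable
  using (via-injection; dec-true; dec-false; ¬¬-excluded-middle)
open import Relation.Nullary.Negation using (¬¬-map)
open import Relation.Unary using (Pred; _∈_)

-- Arguments of a substituted term.

module _ {𝕊 : Signature} where

  var-injective : ∀ {X : Set} {u v : X} → var {𝕊} u ≡ var v → u ≡ v
  var-injective refl = refl

  lookup-binds-var : ∀ {X Y : Set} {n} (ts : Vec (Term 𝕊 X) n)
                     (σ : ∀ v → Any (v occursIn_) ts → Term 𝕊 Y) i {v} →
                     lookup ts i ≡ var v → ∃ λ o → lookup (binds ts σ) i ≡ σ v o
  lookup-binds-var (_ ∷ ts) σ zero    refl = here here , refl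
  lookup-binds-var (_ ∷ ts) σ (suc i) eq   =
    let o , e = lookup-binds-var ts (λ v → σ v ∘ there) i eq in there o , e

  -- `ReceivingForm` is stated with a substitution; the proof needs the arguments that result.
  -- Injectivity of `toℕ` ensures that only position `j` changes.
  generic-update : ∀ f j → ∃ λ us →
    generic {𝕊} f [ var (y (toℕ j)) / x (toℕ j) ] ≡ op f us
    × lookup us j ≡ var (y (toℕ j))
    × (∀ i → i ≢ j → lookup us i ≡ var (x (toℕ i)))
  generic-update f j = binds (tabulate (λ i → var (x (toℕ i)))) σ , refl , at-j , away-from-j
    where
    σ : ∀ v → Any (v occursIn_) _ → Term 𝕊 𝒱
    σ v _ = if does (v ≟𝒱 x (toℕ j)) then var (y (toℕ j)) else var v

    at-j : lookup (binds _ σ) j ≡ var (y (toℕ j))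
    at-j with _ , eq ← lookup-binds-var _ σ j (lookup∘tabulate _ j) =
      trans eq (cong (if_then var (y (toℕ j)) else var (x (toℕ j)))
                     (dec-true (x (toℕ j) ≟𝒱 x (toℕ j)) refl))

    away-from-j : ∀ i → i ≢ j → lookup (binds _ σ) i ≡ var (x (toℕ i))
    away-from-j i i≢j with _ , eq ← lookup-binds-var _ σ i (lookup∘tabulate _ i) =
      trans eq (cong (if_then var (y (toℕ j)) else var (x (toℕ i)))
                     (dec-false (x (toℕ i) ≟𝒱 x (toℕ j))
                                (i≢j ∘ Fin.toℕ-injective ∘ inj₁-injective)))

just-fromPr : ∀ {A : Set} (w : Maybe A) (eq : kind w ≡ pr) → just (fromPr w eq) ≡ w
just-fromPr (just _) _ = refl

module _ {𝕊 : Signature} {S : Set} (𝓛 : Specification 𝕊 S) where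

  open Specification 𝓛
  open Semantics 𝓛
  open Format 𝓛
  open Literal
  open Expression
  open IsRule

  -- Transitions as instances of rules.

  lookup-γ₀s : ∀ {n} s (ts : Vec (μ 𝕊) n) i → lookup (γ₀s s ts) i ≡ γ₀ s (lookup ts i)
  lookup-γ₀s s (_ ∷ _)  zero    = refl
  lookup-γ₀s s (_ ∷ ts) (suc i) = lookup-γ₀s s ts i

  -- Abstracts from the premiss through which `value` reads a variable. The target is an index, so
  -- that an equation for it can be matched; `just` in the condition on `y` entails that the
  -- argument progressed.
  data Instance {n} (ts : Vec (μ 𝕊) n) (ws : Vec (S × Maybe (μ 𝕊)) n) :
                Maybe (Term 𝕊 𝒱) → Maybe (μ 𝕊) → Set where
    terminated : Instance ts ws nothing nothing
    progressed : ∀ {t} (ρ : ∀ v → v occursIn t → μ 𝕊) →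
                 (∀ i o → ρ (x (toℕ i)) o ≡ lookup ts i) →
                 (∀ i o → just (ρ (y (toℕ i)) o) ≡ proj₂ (lookup ws i)) →
                 Instance ts ws (just t) (just (bind t ρ))

  module _ {f} {r : Expression 𝕊 S f} (r∈ : r ∈ Rules f)
           (ts : Vec (μ 𝕊) (arity 𝕊 f)) (ws : Vec (S × Maybe (μ 𝕊)) (arity 𝕊 f))
           (τ≡ : proj₂ (trigger r) ≡ map (map₂ kind) ws) where

    value-x : ∀ i o → value r∈ ts ws τ≡ (x (toℕ i)) o ≡ lookup ts i
    value-x i (j , inj₁ eq) = cong (lookup ts) (Fin.toℕ-injective
      (inj₁-injective (var-injective (trans (sym (premiss-source (isRule r∈) j)) eq))))
    value-x i (j , inj₂ eq) with () ← premiss-target (isRule r∈) j eq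

    value-y : ∀ i o → just (value r∈ ts ws τ≡ (y (toℕ i)) o) ≡ proj₂ (lookup ws i)
    value-y i (j , inj₁ eq) with () ← trans (sym (premiss-source (isRule r∈) j)) eq
    value-y i (j , inj₂ eq) = trans
      (just-fromPr _ (progresses r∈ ts ws τ≡ j eq))
      (cong (proj₂ ∘ lookup ws) (Fin.toℕ-injective
        (inj₂-injective (var-injective (sym (premiss-target (isRule r∈) j eq))))))

    instantiate-instance : ∀ w eq → Instance ts ws w (instantiate r∈ ts ws τ≡ w eq)
    instantiate-instance nothing  _  = terminated
    instantiate-instance (just _) eq =
      progressed _ (λ i o → value-x i (occurrence (x (toℕ i)) o))
                   (λ i o → value-y i (occurrence (y (toℕ i)) o))
      where occurrence = conclusion-vars (isRule r∈) eq

  -- Keeping `γ₀` behind an equation leaves the rule a variable, so that the rules of two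
  -- transitions can be identified by matching on `refl`.
  record Transition (f : Op 𝕊) (s : S) (ts : Vec (μ 𝕊) (arity 𝕊 f)) : Set where
    field
      rule        : Expression 𝕊 S f
      rule∈       : rule ∈ Rules f
      trigger≡    : trigger rule ≡ (s , map (map₂ kind) (γ₀s s ts))
      residual    : Maybe (μ 𝕊)
      γ₀≡         : γ₀ s (op f ts) ≡ (output (conclusion rule) , residual)
      isInstance  : Instance ts (γ₀s s ts) (target (conclusion rule)) residual

  transition : ∀ f s ts → Transition f s ts
  transition f s ts =
    let r , (r∈ , τ≡) , _ = exactly-one f (s , map (map₂ kind) (γ₀s s ts)) in record
    { rule       = r
    ; rule∈      = r∈
    ; trigger≡   = τ≡
    ; residual   = _
    ; γ₀≡        = refl
    ; isInstance = instantiate-instance r∈ ts (γ₀s s ts) (cong proj₂ τ≡) _ refl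
    }

  trigger-unique : ∀ {f r r′} → r ∈ Rules f → r′ ∈ Rules f → trigger r ≡ trigger r′ → r ≡ r′
  trigger-unique {f} {r} {r′} r∈ r′∈ eq =
    let _ , _ , unique = exactly-one f (trigger r′)
    in  trans (sym (unique (r∈ , eq))) (unique (r′∈ , refl))

  -- Equivalence up to finitely many transitions.

  infix 4 _≈[_]_ _~[_]_

  -- Agreement of the first k transitions, where a configuration is the result of
  -- the first of them.
  data _≈[_]_ : S × Maybe (μ 𝕊) → ℕ → S × Maybe (μ 𝕊) → Set where
    none  : ∀ {c d} → c ≈[ zero ] d
    final : ∀ {s k} → (s , nothing) ≈[ suc k ] (s , nothing)
    next  : ∀ {s k p q} → γ₀ s p ≈[ k ] γ₀ s q → (s , just p) ≈[ suc k ] (s , just q)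

  _~[_]_ : μ 𝕊 → ℕ → μ 𝕊 → Set
  p ~[ k ] q = ∀ s → γ₀ s p ≈[ k ] γ₀ s q

  ≈-pred : ∀ {k c d} → c ≈[ suc k ] d → c ≈[ k ] d
  ≈-pred {zero}  _        = none
  ≈-pred {suc _} final    = final
  ≈-pred {suc _} (next e) = next (≈-pred e)

  ≈-map₂-kind : ∀ {k c d} → c ≈[ suc k ] d → map₂ kind c ≡ map₂ kind d
  ≈-map₂-kind final    = refl
  ≈-map₂-kind (next _) = refl

  -- One transition already fixes the output and kind of each argument, hence the trigger: both
  -- sides use the same rule.
  ≈-map-kind : ∀ {n k s} (p q : Vec (μ 𝕊) n) →
               (∀ i → γ₀ s (lookup p i) ≈[ suc k ] γ₀ s (lookup q i)) →
               map (map₂ kind) (γ₀s s p) ≡ map (map₂ kind) (γ₀s s q)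
  ≈-map-kind []      []      _ = refl
  ≈-map-kind (_ ∷ p) (_ ∷ q) e = cong₂ _∷_ (≈-map₂-kind (e zero)) (≈-map-kind p q (e ∘ suc))

  ≈-next : ∀ {k s s′ p q} → (s , just p) ≈[ suc k ] (s′ , just q) → γ₀ s p ≈[ k ] γ₀ s q
  ≈-next (next e) = e

  ≈⇒states≡ : ∀ k {c d} → c ≈[ suc k ] d → states c k ≡ states d k
  ≈⇒states≡ zero    final    = refl
  ≈⇒states≡ zero    (next _) = refl
  ≈⇒states≡ (suc k) final    = refl
  ≈⇒states≡ (suc k) (next e) = ≈⇒states≡ k e

  -- Termination of a transition shows only in the following entry, so agreement of `k` transitions
  -- may depend on entry `k`, counted from 0.
  states≡⇒≈ : ∀ k {c d} → (∀ i → states c i ≡ states d i) → c ≈[ k ] d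
  states≡⇒≈ zero    _ = none
  states≡⇒≈ (suc k) {_ , w} {_ , w′} eq with refl ← just-injective (eq 0) with w | w′
  ... | nothing | nothing = final
  ... | just _  | just _  = next (states≡⇒≈ k (eq ∘ suc))
  ... | just _  | nothing with () ← eq 1
  ... | nothing | just _  with () ← eq 1

  -- Outputs and kinds can be compared at each of the `k` transitions, and a mismatch refutes the
  -- double negation.
  ≈-stable : DecidableEquality S → ∀ {k c d} → ¬ ¬ (c ≈[ k ] d) → c ≈[ k ] d
  ≈-stable _≟_ {zero} _ = none
  ≈-stable _≟_ {suc k} {s , w} {s′ , w′} ¬¬e with s ≟ s′
  ... | no s≢s′ = contradiction (λ { final → s≢s′ refl ; (next _) → s≢s′ refl }) ¬¬e
  ... | yes refl with w | w′
  ...   | nothing | nothing = final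
  ...   | just _  | just _  = next (≈-stable _≟_ (¬¬-map ≈-next ¬¬e))
  ...   | just _  | nothing = contradiction (λ ()) ¬¬e
  ...   | nothing | just _  = contradiction (λ ()) ¬¬e

  ≈-by-cases : DecidableEquality S → ∀ {A : Set} {k c d} →
               (A → c ≈[ k ] d) → (¬ A → c ≈[ k ] d) → c ≈[ k ] d
  ≈-by-cases _≟_ f g = ≈-stable _≟_ λ ¬e →
    ¬¬-excluded-middle λ { (yes a) → ¬e (f a) ; (no ¬a) → ¬e (g ¬a) }

  -- Congruence, one level at a time.

  Congruent : ℕ → Set
  Congruent k = ∀ f p q → (∀ i → lookup p i ~[ k ] lookup q i) → op f p ~[ k ] op f q

  module _ {k} (congruent : Congruent k) where

    bind-~  : ∀ (t : Term 𝕊 𝒱) {ρ σ} →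
              (∀ v o → ρ v o ~[ k ] σ v o) → bind t ρ ~[ k ] bind t σ
    binds-~ : ∀ {n} (ts : Vec (Term 𝕊 𝒱) n) {ρ σ} → (∀ v o → ρ v o ~[ k ] σ v o) →
              ∀ i → lookup (binds ts ρ) i ~[ k ] lookup (binds ts σ) i

    bind-~ (var v)   e = e v here
    bind-~ (op f ts) e = congruent f _ _ (binds-~ ts λ v o → e v (there o))

    binds-~ (t ∷ _)  e zero    = bind-~ t λ v o → e v (here o)
    binds-~ (_ ∷ ts) e (suc i) = binds-~ ts (λ v o → e v (there o)) i

    -- The common output accounts for one transition, so congruence at level `k` yields level
    -- `suc k`. `P` will be all of `Xs`, or `Xs` without the `j`-th variable.
    instance-≈ : ∀ {n} {ps qs : Vec (μ 𝕊) n} {us vs w a b} {P : Pred 𝒱 _} {s} →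
                 VarsIn P w →
                 (∀ {v} → v ∈ P → ∃ λ i → v ≡ x (toℕ i) × lookup ps i ~[ k ] lookup qs i) →
                 Instance ps us w a → Instance qs vs w b → (s , a) ≈[ suc k ] (s , b)
    instance-≈ vars e terminated terminated = final
    instance-≈ {ps = ps} {qs} {s = s} vars e (progressed {t} ρ ρ-x _) (progressed σ σ-x _) =
      next (bind-~ t ρ~σ s)
      where
      ρ~σ : ∀ v o → ρ v o ~[ k ] σ v o
      ρ~σ v o with i , refl , p~q ← e (vars refl v o) =
        subst₂ _~[ k ]_ (sym (ρ-x i o)) (sym (σ-x i o)) p~q

  StreamlinedAt : (f : Op 𝕊) → Fin (arity 𝕊 f) → Set
  StreamlinedAt f j = (∀ {r} → r ∈ Rules f → Receiving r → ReceivingForm j r)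
                    × (∀ {r} → r ∈ Rules f → ¬ Receiving r → NonReceivingForm j r)

  -- Only position `j` is restricted to the current state: the other arguments may first run in a
  -- state reached later.
  CongruentAt : ℕ → (f : Op 𝕊) → Fin (arity 𝕊 f) → Set
  CongruentAt k f j = ∀ p q → (∀ i → i ≢ j → lookup p i ~[ k ] lookup q i) →
    ∀ s → γ₀ s (lookup p j) ≈[ k ] γ₀ s (lookup q j) → γ₀ s (op f p) ≈[ k ] γ₀ s (op f q)

  generic-update-instance : ∀ f j {ps ws a} →
    Instance ps ws (just (generic f [ var (y (toℕ j)) / x (toℕ j) ])) a →
    ∃ λ ps′ → a ≡ just (op f ps′) × just (lookup ps′ j) ≡ proj₂ (lookup ws j)
            × (∀ i → i ≢ j → lookup ps′ i ≡ lookup ps i)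
  generic-update-instance f j (progressed ρ ρ-x ρ-y)
    with us , refl , at-j , away-from-j ← generic-update f j =
    _ , refl
    , (let o , eq = lookup-binds-var us _ j at-j in trans (cong just eq) (ρ-y j (there o)))
    , λ i i≢j → let o , eq = lookup-binds-var us _ i (away-from-j i i≢j)
                in  trans eq (ρ-x i (there o))

  var-y-instance : ∀ {n} j {ps : Vec (μ 𝕊) n} {ws a} →
    Instance ps ws (just (var (y (toℕ j)))) a → a ≡ proj₂ (lookup ws j)
  var-y-instance j (progressed ρ _ ρ-y) = ρ-y j here

  -- In the first case the residuals are again `f`-terms, and their `j`-th arguments are related on
  -- the very state now reached, as `CongruentAt` asks. In the second they are the residuals of the
  -- `j`-th arguments themselves.
  receiving-≈ : ∀ {k f j ps qs us vs w a b} → CongruentAt k f j →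
    (∀ i → i ≢ j → lookup ps i ~[ k ] lookup qs i) →
    w ≡ just (generic f [ var (y (toℕ j)) / x (toℕ j) ]) ⊎ w ≡ just (var (y (toℕ j))) →
    Instance ps us w a → Instance qs vs w b → lookup us j ≈[ suc k ] lookup vs j →
    (proj₁ (lookup us j) , a) ≈[ suc k ] (proj₁ (lookup us j) , b)
  receiving-≈ {f = f} {j} {us = us} {vs} congruentAt ps~qs (inj₁ refl) ip iq e
    with ps′ , refl , at-j , away-from-j ← generic-update-instance f j ip
    with qs′ , refl , at-j′ , away-from-j′ ← generic-update-instance f j iq
    with lookup us j | lookup vs j | at-j | at-j′ | e
  ... | s , _ | .s , _ | refl | refl | next e′ = next (congruentAt ps′ qs′
    (λ i i≢j → subst₂ _~[ _ ]_ (sym (away-from-j i i≢j)) (sym (away-from-j′ i i≢j)) (ps~qs i i≢j))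
    s e′)
  receiving-≈ {j = j} {us = us} {vs} congruentAt ps~qs (inj₂ refl) ip iq e
    with refl ← var-y-instance j ip
    with refl ← var-y-instance j iq
    with lookup us j | lookup vs j | e
  ... | _ | _ | final   = final
  ... | _ | _ | next e′ = next e′

  -- Induction on the number of transitions.

  module _ (_≟_ : DecidableEquality S) where

    congruentAt-suc : ∀ {k f j} → StreamlinedAt f j → Congruent k → CongruentAt k f j →
                      CongruentAt (suc k) f j
    congruentAt-suc {k} {f} {j} (receiving-form , nonreceiving-form) congruent congruentAt
                    p q p~q s pj≈qj = from-transitions (transition f s p) (transition f s q)
      where
      related : ∀ i → γ₀ s (lookup p i) ≈[ suc k ] γ₀ s (lookup q i)
      related i with i Fin.≟ j
      ... | yes refl = pj≈qj
      ... | no i≢j   = p~q i i≢j s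

      from-transitions : Transition f s p → Transition f s q →
                         γ₀ s (op f p) ≈[ suc k ] γ₀ s (op f q)
      from-transitions
        record { rule = r ; rule∈ = r∈ ; trigger≡ = τ≡ ; γ₀≡ = γp≡ ; isInstance = ip }
        record { rule∈ = r′∈ ; trigger≡ = τ′≡ ; γ₀≡ = γq≡ ; isInstance = iq }
        with refl ← trigger-unique r∈ r′∈
                      (trans τ≡ (trans (cong (s ,_) (≈-map-kind p q related)) (sym τ′≡)))
        = subst₂ _≈[ suc k ]_ (sym γp≡) (sym γq≡) (≈-by-cases _≟_ receiving nonreceiving)
        where
        nonreceiving : ¬ Receiving r → _ ≈[ suc k ] _
        nonreceiving ¬rec = instance-≈ congruent (nonreceiving-form r∈ ¬rec)
          -- Excluding position `j` is essential: there the arguments are related on `s` only, while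
          -- the target may run them in another state.
          (λ { ((i , refl) , ≢xj) →
               i , refl , λ s′ → ≈-pred (p~q i (λ { refl → ≢xj refl }) s′) })
          ip iq

        -- The premisses are tied to the actual arguments by the trigger.
        output-premiss : output (premiss r j) ≡ proj₁ (lookup (γ₀s s p) j)
        output-premiss =
          trans (sym (cong proj₁ (lookup-map j _ (premisses r))))
          (trans (cong (λ τ → proj₁ (lookup (proj₂ τ) j)) τ≡)
          (cong proj₁ (lookup-map j _ (γ₀s s p))))

        receiving : Receiving r → _ ≈[ suc k ] _
        receiving rec = let _ , output≡ , target≡ , _ = receiving-form r∈ rec in
          subst (λ s′ → (s′ , _) ≈[ suc k ] (s′ , _))
                (sym (trans output≡ output-premiss))
                (receiving-≈ congruentAt (λ i i≢j s′ → ≈-pred (p~q i i≢j s′)) target≡ ip iq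
                  (subst₂ _≈[ suc k ]_ (sym (lookup-γ₀s s p j)) (sym (lookup-γ₀s s q j)) pj≈qj))

    -- The conclusion depends on the input alone, so both sides share it even without comparing the
    -- arguments; its target mentions only arguments, never their residuals.
    congruent-passive : ∀ {k f} → Passive f → Congruent k → ∀ p q →
      (∀ i → lookup p i ~[ suc k ] lookup q i) → op f p ~[ suc k ] op f q
    congruent-passive {k} {f} passive congruent p q p~q s
      with transition f s p | transition f s q
    ... | record { rule∈ = r∈ ; trigger≡ = τ≡ ; γ₀≡ = γp≡ ; isInstance = ip }
        | record { rule∈ = r′∈ ; trigger≡ = τ′≡ ; residual = b ; γ₀≡ = γq≡ ; isInstance = iq }
      with vars , determined ← passive r∈
      with conclusion≡ ← determined r′∈ (trans (cong proj₁ τ′≡) (sym (cong proj₁ τ≡)))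
      = subst₂ _≈[ suc k ]_ (sym γp≡)
          (sym (trans γq≡ (cong (λ l → output l , b) conclusion≡)))
          (instance-≈ congruent vars
            (λ { (i , eq) → i , eq , λ s′ → ≈-pred (p~q i s′) })
            ip (subst (λ l → Instance q (γ₀s s q) (target l) b) conclusion≡ iq))

    module _ (streamlined : Streamlined) where

      -- At `suc k`, `congruent` calls `congruentAt` at the same level, but `congruentAt` calls both
      -- only at `k`, so the mutual induction is well-founded.
      congruent   : ∀ k → Congruent k
      congruentAt : ∀ k {f j} → StreamlinedAt f j → CongruentAt k f j

      congruent zero    f p q p~q s = none
      congruent (suc k) f p q p~q s = ≈-by-cases _≟_ {A = Passive f}
        (λ passive → congruent-passive passive (congruent k) p q p~q s)
        (λ active → let j , streamlinedAt = streamlined f active in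
          congruentAt (suc k) streamlinedAt p q (λ i _ → p~q i) s (p~q j s))

      congruentAt zero    _             p q p~q s pj≈qj = none
      congruentAt (suc k) streamlinedAt =
        congruentAt-suc streamlinedAt (congruent k) (congruentAt k streamlinedAt)

theorem5p4 : (𝕊 : Signature) (S : Set) → S ↣ ℕ →
    (𝓛 : Specification 𝕊 S) → Format.Streamlined 𝓛 →
    let open Semantics 𝓛 in
    (f : Op 𝕊) (p q : Vec (μ 𝕊) (arity 𝕊 f)) →
    (∀ i → ∀ s → ⟦ lookup p i ⟧ s ≈ ⟦ lookup q i ⟧ s) →
    ∀ s → ⟦ op f p ⟧ s ≈ ⟦ op f q ⟧ s
theorem5p4 𝕊 S S↣ℕ 𝓛 streamlined f p q p≈q s k =
  -- Entry `k`, counted from 0, is the output of transition `k + 1`; hence the level `suc k`.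
  ≈⇒states≡ 𝓛 k
    (congruent 𝓛 (via-injection S↣ℕ ℕ._≟_) streamlined (suc k) f p q
      (λ i s′ → states≡⇒≈ 𝓛 (suc k) (p≈q i s′)) s)
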